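{- For all integers $a\ge 3$ and all integers $k\ge 3$, $$R(a,k)\le 2^{\,R(a-2,k-1)^{a-1}\; 2^{\,R(a-2,k-1)^{a-2}}}.$$
   Context: For a set $X$ and an integer $a\ge 1$, $\binom{X}{a}$ denotes the set of all $a$-element subsets of $X$, and $[n]=\{1,\dots,n\}$. Given a coloring $COL$ of $\binom{[n]}{a}$, a set $H\subseteq[n]$ is $a$-homogeneous for $COL$ if all elements of $\binom{H}{a}$ have the same color (vacuously true if $|H|<a$); $a=1$ is allowed, in which case a coloring of $\binom{[n]}{1}$ is just a coloring of the points of $[n]$. For integers $a,k\ge 1$, $R(a,k)$ denotes the least $n$ such that for every 2-coloring of $\binom{[n]}{a}$ there exists an $a$-homogeneous set $H\subseteq [n]$ with $|H|=k$ (this number exists by Ramsey's theorem). -}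

module Defs where

open import Data.Bool.Base using (Bool; true; false)
open import Data.Bool.Properties using () renaming (_≟_ to _≟ᵇ_)
open import Data.Fin.Subset using (Subset; inside; outside; ⊥; ⊤; _⊆_; ∣_∣)
open import Data.Fin.Subset.Properties
  using (∣⊥∣≡0; ∣⊤∣≡n; drop-∷-⊆; out⊆; in⊆in; ⊆-refl; ⊆-trans; ⊥⊆; p⊆q⇒∣p∣≤∣q∣;
         anySubset?; _⊆?_)
open import Data.Nat.Base using (ℕ; zero; suc; _+_; _≤_; z≤n; s≤s; s≤s⁻¹)
open import Data.Nat.Properties
  using (≡-irrelevant; _≟_; ≤-reflexive; ≤-trans; m≤m+n; m≤n+m; suc-injective)
open import Data.Product.Base using (∃; _×_; _,_; proj₁; uncurry)
open import Data.Sum.Base using (_⊎_; inj₁; inj₂; [_,_]′)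
open import Data.Vec.Base using ([]; _∷_; here)
open import Function.Base using (_∘_; const)
open import Relation.Binary.PropositionalEquality
  using (_≡_; _≗_; refl; sym; trans; cong; subst)
open import Relation.Nullary using (Dec; yes; no; ¬?; contradiction)
open import Relation.Nullary.Decidable using (map′; decidable-stable; _×-dec_; _→-dec_)
open import Level using (0ℓ)
open import Relation.Unary using (Pred; Decidable)

-- [n] is Fin n, so the points are 0, …, n-1 rather than 1, …, n.

[_]choose_ : ℕ → ℕ → Set
[ n ]choose a = ∃ λ (S : Subset n) → ∣ S ∣ ≡ a

Coloring : ℕ → ℕ → Set
Coloring n a = [ n ]choose a → Bool

Homogeneous : ∀ {n a} → Coloring n a → Subset n → Set
Homogeneous {n} {a} COL H =
  (S T : [ n ]choose a) → proj₁ S ⊆ H → proj₁ T ⊆ H → COL S ≡ COL T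

Ramsey : ℕ → ℕ → ℕ → Set
Ramsey a k n = (COL : Coloring n a) → ∃ λ H → Homogeneous COL H × ∣ H ∣ ≡ k

IsLeast : Pred ℕ 0ℓ → Pred ℕ 0ℓ
IsLeast P n = P n × (∀ {m} → P m → n ≤ m)

private

  choose-≡ : ∀ {n a} {S T : [ n ]choose a} → proj₁ S ≡ proj₁ T → S ≡ T
  choose-≡ {S = S , p} {T = .S , q} refl = cong (S ,_) (≡-irrelevant p q)

  with₀ : ∀ {n a} → [ n ]choose a → [ suc n ]choose (suc a)
  with₀ (S , e) = inside ∷ S , cong suc e

  without₀ : ∀ {n a} → [ n ]choose a → [ suc n ]choose a
  without₀ (S , e) = outside ∷ S , e

  Mono : ∀ {n a} → Coloring n a → Bool → Subset n → Set
  Mono {n} {a} c b H = (S : [ n ]choose a) → proj₁ S ⊆ H → c S ≡ b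

  MonoIn : ∀ {n a} → Coloring n a → Bool → Subset n → ℕ → Set
  MonoIn c b X k = ∃ λ H → H ⊆ X × ∣ H ∣ ≡ k × Mono c b H

  shrink : ∀ {n} (X : Subset n) k → k ≤ ∣ X ∣ → ∃ λ H → H ⊆ X × ∣ H ∣ ≡ k
  shrink {n} X zero _ = ⊥ , ⊥⊆ , ∣⊥∣≡0 n
  shrink (outside ∷ X) k@(suc _) k≤ with H , H⊆X , e ← shrink X k k≤ =
    outside ∷ H , out⊆ H⊆X , e
  shrink (inside ∷ X) (suc k) k≤ with H , H⊆X , e ← shrink X k (s≤s⁻¹ k≤) =
    inside ∷ H , in⊆in H⊆X , cong suc e

  empty : ∀ {n} (S : Subset n) → ∣ S ∣ ≡ 0 → S ≡ ⊥
  empty []            _ = refl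
  empty (outside ∷ S) e = cong (outside ∷_) (empty S e)

  mono-⊥ : ∀ {n a} (c : Coloring n (suc a)) b X → MonoIn c b X 0
  mono-⊥ {n} c b X = ⊥ , ⊥⊆ , ∣⊥∣≡0 n , λ (S , e) S⊆⊥ →
    contradiction (subst (_≤ 0) e (subst (∣ S ∣ ≤_) (∣⊥∣≡0 n) (p⊆q⇒∣p∣≤∣q∣ S⊆⊥))) λ ()

  lift : ∀ {n a} {c : Coloring (suc n) a} {b x X Y k} → X ⊆ Y →
         MonoIn (c ∘ without₀) b X k → MonoIn c b (x ∷ Y) k
  lift X⊆Y (H , H⊆X , e , mono) =
    outside ∷ H , out⊆ (⊆-trans H⊆X X⊆Y) , e , λ where
      (outside ∷ S , p) S⊆ → mono (S , p) (drop-∷-⊆ S⊆)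
      (inside  ∷ S , p) S⊆ → contradiction (S⊆ here) λ ()

  extend : ∀ {n a} {c : Coloring (suc n) (suc a)} {b X Y k} → X ⊆ Y →
           Mono (c ∘ with₀) b X →
           MonoIn (c ∘ without₀) b X k → MonoIn c b (inside ∷ Y) (suc k)
  extend {c = c} X⊆Y link (H , H⊆X , e , mono) =
    inside ∷ H , in⊆in (⊆-trans H⊆X X⊆Y) , cong suc e , λ where
      (outside ∷ S , p) S⊆ → mono (S , p) (drop-∷-⊆ S⊆)
      (inside  ∷ S , p) S⊆ →
        trans (cong c (choose-≡ refl))
              (link (S , suc-injective p) (⊆-trans (drop-∷-⊆ S⊆) H⊆X))

  -- The asymmetric recursion r_a(p,q) ≤ 1 + r_{a-1}(r_a(p-1,q), r_a(p,q-1)):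
  -- fix a point, first make the coloring of the sets through it monochromatic.
  bound : ℕ → ℕ → ℕ → ℕ
  bound zero    p       q       = p + q
  bound (suc a) zero    q       = 0
  bound (suc a) (suc p) zero    = 0
  bound (suc a) (suc p) (suc q) =
    suc (bound a (bound (suc a) p (suc q)) (bound (suc a) (suc p) q))

  bound-ramsey : ∀ a p q {n} (c : Coloring n a) (X : Subset n) →
                 bound a p q ≤ ∣ X ∣ → MonoIn c true X p ⊎ MonoIn c false X q
  bound-ramsey zero p q {n} c X ≤X with c (⊥ , ∣⊥∣≡0 n) in eq
  ... | true  with H , H⊆X , e ← shrink X p (≤-trans (m≤m+n p q) ≤X) =
    inj₁ (H , H⊆X , e , λ (S , z) _ → trans (cong c (choose-≡ (empty S z))) eq)
  ... | false with H , H⊆X , e ← shrink X q (≤-trans (m≤n+m q p) ≤X) =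
    inj₂ (H , H⊆X , e , λ (S , z) _ → trans (cong c (choose-≡ (empty S z))) eq)
  bound-ramsey (suc a) zero    q    c X _ = inj₁ (mono-⊥ c true X)
  bound-ramsey (suc a) (suc p) zero c X _ = inj₂ (mono-⊥ c false X)
  bound-ramsey (suc a) (suc p) (suc q) c (outside ∷ X) ≤X
    with bound-ramsey (suc a) (suc p) (suc q) (c ∘ without₀) X ≤X
  ... | inj₁ m = inj₁ (lift ⊆-refl m)
  ... | inj₂ m = inj₂ (lift ⊆-refl m)
  bound-ramsey (suc a) (suc p) (suc q) c (inside ∷ X) ≤X
    with bound-ramsey a _ _ (c ∘ with₀) X (s≤s⁻¹ ≤X)
  ... | inj₁ (Y , Y⊆X , e , link)
    with bound-ramsey (suc a) p (suc q) (c ∘ without₀) Y (≤-reflexive (sym e))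
  ...   | inj₁ m = inj₁ (extend Y⊆X link m)
  ...   | inj₂ m = inj₂ (lift Y⊆X m)
  bound-ramsey (suc a) (suc p) (suc q) c (inside ∷ X) ≤X
      | inj₂ (Y , Y⊆X , e , link)
    with bound-ramsey (suc a) (suc p) q (c ∘ without₀) Y (≤-reflexive (sym e))
  ...   | inj₁ m = inj₁ (lift Y⊆X m)
  ...   | inj₂ m = inj₂ (extend Y⊆X link m)

ramsey-theorem : ∀ a k → ∃ (Ramsey a k)
ramsey-theorem a k = N , λ c →
  [ (λ (H , _ , e , mono) → H , hom mono , e)
  , (λ (H , _ , e , mono) → H , hom mono , e)
  ]′ (bound-ramsey a k k c ⊤ (≤-reflexive (sym (∣⊤∣≡n N))))
  where
  N : ℕ
  N = bound a k k

  hom : ∀ {c : Coloring N a} {b H} → Mono c b H → Homogeneous c H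
  hom mono S T S⊆H T⊆H = trans (mono S S⊆H) (sym (mono T T⊆H))

-- The least witness is found by search, so Ramsey a k has to be decidable.

private

  all? : ∀ {n} {P : Pred (Subset n) 0ℓ} → Decidable P → Dec (∀ S → P S)
  all? P? = map′ (λ ¬∃¬ S → decidable-stable (P? S) λ ¬p → ¬∃¬ (S , ¬p))
                 (λ ∀P (S , ¬p) → ¬p (∀P S))
                 (¬? (anySubset? (¬? ∘ P?)))

  allChoose? : ∀ {n a} {P : Pred ([ n ]choose a) 0ℓ} → Decidable P → Dec (∀ S → P S)
  allChoose? {n} {a} {P} P? = map′ (λ f (S , e) → f S e) (λ f S e → f (S , e)) (all? fibre?)
    where
    fibre? : Decidable λ S → (e : ∣ S ∣ ≡ a) → P (S , e)
    fibre? S with ∣ S ∣ ≟ a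
    ... | no  ¬e = yes λ e → contradiction e ¬e
    ... | yes e  = map′ (λ p e′ → subst P (choose-≡ refl) p) (λ f → f e) (P? (S , e))

  homogeneous? : ∀ {n a} (COL : Coloring n a) → Decidable (Homogeneous COL)
  homogeneous? COL H = map′ (λ f S T S⊆ T⊆ → f S T S⊆ T⊆) (λ f → f)
    (allChoose? λ S → allChoose? λ T →
      (proj₁ S ⊆? H) →-dec ((proj₁ T ⊆? H) →-dec (COL S ≟ᵇ COL T)))

  join : ∀ {n} → (Subset n → Bool) → (Subset n → Bool) → Subset (suc n) → Bool
  join f g (outside ∷ S) = f S
  join f g (inside  ∷ S) = g S

  allFunctions? : ∀ n {P : Pred (Subset n → Bool) 0ℓ} →
                  (∀ {f g} → f ≗ g → P f → P g) → Decidable P → Dec (∀ f → P f)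
  allFunctions? zero {P} ext P? =
    map′ (λ all f → ext (λ { [] → refl }) (pick all (f [])))
         (λ all → all (const true) , all (const false))
         (P? (const true) ×-dec P? (const false))
    where
    pick : P (const true) × P (const false) → ∀ b → P (const b)
    pick (p , _) true  = p
    pick (_ , p) false = p
  allFunctions? (suc n) ext P? =
    map′ (λ all f → ext (λ { (outside ∷ S) → refl ; (inside ∷ S) → refl })
                        (all (f ∘ (outside ∷_)) (f ∘ (inside ∷_))))
         (λ all f g → all (join f g))
         (allFunctions? n
           (λ f≗f′ all g → ext (λ { (outside ∷ S) → f≗f′ S ; (inside ∷ S) → refl }) (all g))
           λ f → allFunctions? n
             (λ g≗g′ → ext (λ { (outside ∷ S) → refl ; (inside ∷ S) → g≗g′ S }))
             λ g → P? (join f g))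

  ramsey? : ∀ a k → Decidable (Ramsey a k)
  ramsey? a k n =
    map′ (λ all COL → ext (restrict-total COL) (all (total COL)))
         (λ ram f → ram (f ∘ proj₁))
         (allFunctions? n (λ f≗g → ext (f≗g ∘ proj₁)) λ f → found? (f ∘ proj₁))
    where
    Found : Coloring n a → Set
    Found COL = ∃ λ H → Homogeneous COL H × ∣ H ∣ ≡ k

    found? : Decidable Found
    found? COL = anySubset? λ H → homogeneous? COL H ×-dec (∣ H ∣ ≟ k)

    ext : ∀ {f g : Coloring n a} → f ≗ g → Found f → Found g
    ext f≗g (H , hom , e) =
      H , (λ S T S⊆ T⊆ → trans (sym (f≗g S)) (trans (hom S T S⊆ T⊆) (f≗g T))) , e

    total : Coloring n a → Subset n → Bool
    total COL S with ∣ S ∣ ≟ a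
    ... | yes e = COL (S , e)
    ... | no  _ = false

    restrict-total : ∀ COL → total COL ∘ proj₁ ≗ COL
    restrict-total COL (S , e) with ∣ S ∣ ≟ a
    ... | yes _ = cong COL (choose-≡ refl)
    ... | no ¬e = contradiction e ¬e

  least : ∀ {P : Pred ℕ 0ℓ} → Decidable P → ∀ n → P n → ∃ (IsLeast P)
  least {P} P? zero    p = 0 , p , λ _ → z≤n
  least {P} P? (suc n) p with P? 0
  ... | yes p₀ = 0 , p₀ , λ _ → z≤n
  ... | no ¬p₀ with m , pₘ , min ← least (P? ∘ suc) n p =
    suc m , pₘ , λ {i} → min′ min i
    where
    min′ : ∀ {m} → (∀ {i} → P (suc i) → m ≤ i) → ∀ i → P i → suc m ≤ i
    min′ min zero    p₀ = contradiction p₀ ¬p₀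
    min′ min (suc _) pᵢ = s≤s (min pᵢ)

-- Abstract, so that the type checker never runs the search.

abstract
  leastRamsey : ∀ a k → ∃ (IsLeast (Ramsey a k))
  leastRamsey a k = uncurry (least (ramsey? a k)) (ramsey-theorem a k)

R : ℕ → ℕ → ℕ
R a k = proj₁ (leastRamsey a k)

{-# OPTIONS --safe #-}

-- Put b = a - 2 and m = R(b, k-1). Vertices are placed one at a time in a search tree of depth m,
-- keeping a list Z of candidates. A vertex w at the end of a branch ys is placed after asking,
-- for every b-subset S of ys, for the colour of S ∪ {w, z}; each question is settled for all z ∈ Z
-- by passing to the larger half of Z, and the answers decide where later vertices branch.
-- On a branch, the colour of an a-set therefore depends only on its first b elements, so a branch
-- with m vertices together with one more vertex contains the required set, by the definition of m.
-- The tree has at most m 2^(C(m,b)) places, and filling one costs a factor 2^(C(m-1,b)+1) ≤ 2^(m^b).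

module Submission where

open import Defs
open import Data.Bool.Base using (Bool; true; false)
open import Data.Fin.Base using (Fin; zero; suc)
open import Data.Fin.Subset
  using (Subset; inside; outside; _⊆_; _∈_; _∉_; _∪_; _∩_; ⁅_⁆; ∣_∣)
open import Data.Fin.Subset.Properties
  using (∉⊥; ∪-identityˡ; x∈⁅x⁆; x∈⁅y⁆⇒x≡y; x∈p∪q⁺; x∈p∪q⁻; x∈p∩q⁺; x∈p∩q⁻; ⊆-antisym;
         drop-∷-⊆; out⊆; ∣⊥∣≡0)
open import Data.List.Base using (List; []; _∷_; length; allFin)
open import Data.List.Properties using (length-tabulate)
open import Data.List.Relation.Binary.Sublist.Propositional
  using ([]; _∷_; _∷ʳ_; ⊆-refl; ⊆-trans) renaming (_⊆_ to _⊑_)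
open import Data.List.Relation.Binary.Sublist.Propositional.Properties using (All-resp-⊆)
open import Data.List.Relation.Unary.All as All using (All; []; _∷_)
open import Data.List.Relation.Unary.AllPairs using ([]; _∷_)
open import Data.List.Relation.Unary.Unique.Propositional using (Unique)
open import Data.List.Relation.Unary.Unique.Propositional.Properties using (tabulate⁺)
open import Data.Nat.Base
open import Data.Nat.Properties
open import Data.Product.Base using (∃; ∃₂; _×_; _,_; proj₁; proj₂)
open import Data.Sum.Base using (_⊎_; inj₁; inj₂)
open import Data.Unit.Base using (tt) renaming (⊤ to Unit)
open import Data.Vec.Base as Vec using (Vec; []; _∷_; here; there; lookup)
open import Data.Vec.Properties using ([]=⇒lookup; lookup⇒[]=; lookup-map)
open import Algebra.Properties.CommutativeSemigroup *-commutativeSemigroup using (xy∙z≈y∙zx; xy∙z≈xz∙y)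
open import Function.Base using (id; _∘_)
open import Relation.Binary.PropositionalEquality
open import Relation.Nullary using (yes; no; contradiction)

private variable
  A : Set
  n d b r : ℕ

-- Binomial coefficients

C : ℕ → ℕ → ℕ
C d       zero    = 1
C zero    (suc b) = 0
C (suc d) (suc b) = C d (suc b) + C d b

C-monoˡ-suc : ∀ d b → C d b ≤ C (suc d) b
C-monoˡ-suc d zero    = ≤-refl
C-monoˡ-suc d (suc b) = m≤m+n _ _

C-monoˡ : ∀ {d e} b → d ≤′ e → C d b ≤ C e b
C-monoˡ b (≤′-reflexive refl) = ≤-refl
C-monoˡ b (≤′-step d≤e)   = ≤-trans (C-monoˡ b d≤e) (C-monoˡ-suc _ b)

C≤^ : ∀ d b → C d b ≤ d ^ b
C≤^ d       zero    = ≤-refl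
C≤^ zero    (suc b) = z≤n
C≤^ (suc d) (suc b) = begin
  C d (suc b) + C d b            ≤⟨ +-mono-≤ (C≤^ d (suc b)) (C≤^ d b) ⟩
  d * d ^ b + d ^ b              ≡⟨ +-comm (d * d ^ b) (d ^ b) ⟩
  suc d * d ^ b                  ≤⟨ *-monoʳ-≤ (suc d) (^-monoˡ-≤ b (n≤1+n d)) ⟩
  suc d * suc d ^ b              ∎
  where open ≤-Reasoning

-- The extra 1, which will pay for the vertex that an insertion removes, fits into the summand
-- `suc d ^ b` gained by passing from `d` to `suc d`.
C<suc^ : ∀ d b → suc (C d (suc b)) ≤ suc d ^ suc b
C<suc^ d b = begin
  1 + C d (suc b)                ≤⟨ +-mono-≤ (m^n>0 (suc d) b) (C≤^ d (suc b)) ⟩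
  suc d ^ b + d * d ^ b          ≤⟨ +-monoʳ-≤ (suc d ^ b) (*-monoʳ-≤ d (^-monoˡ-≤ b (n≤1+n d))) ⟩
  suc d ^ b + d * suc d ^ b      ∎
  where open ≤-Reasoning

-- Tables of answers and functions on them

-- A Boolean for each b-subset of a d-set, split along the Pascal recursion.
Table : ℕ → ℕ → Set
Table d       zero    = Bool
Table zero    (suc b) = Unit
Table (suc d) (suc b) = Table d (suc b) × Table d b

-- Junk value false at subsets whose size is not b.
entry : ∀ d b → Table d b → Subset d → Bool
entry d       zero    β       S             = β
entry zero    (suc b) _       S             = false
entry (suc d) (suc b) (f , g) (outside ∷ S) = entry d (suc b) f S
entry (suc d) (suc b) (f , g) (inside  ∷ S) = entry d b g S

sumTable : ∀ d b → (Table d b → ℕ) → ℕ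
sumTable d       zero    h = h true + h false
sumTable zero    (suc b) h = h tt
sumTable (suc d) (suc b) h = sumTable d (suc b) λ f → sumTable d b λ g → h (f , g)

sumTable-cong : ∀ d b {h h′ : Table d b → ℕ} → h ≗ h′ → sumTable d b h ≡ sumTable d b h′
sumTable-cong d       zero    h≗h′ = cong₂ _+_ (h≗h′ true) (h≗h′ false)
sumTable-cong zero    (suc b) h≗h′ = h≗h′ tt
sumTable-cong (suc d) (suc b) h≗h′ =
  sumTable-cong d (suc b) λ f → sumTable-cong d b λ g → h≗h′ (f , g)

sumTable-const : ∀ d b c → sumTable d b (λ _ → c) ≡ 2 ^ C d b * c
sumTable-const d       zero    c = cong (c +_) (sym (+-identityʳ c))
sumTable-const zero    (suc b) c = sym (+-identityʳ c)
sumTable-const (suc d) (suc b) c = begin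
  sumTable d (suc b) (λ f → sumTable d b λ g → c)
    ≡⟨ sumTable-cong d (suc b) (λ f → sumTable-const d b c) ⟩
  sumTable d (suc b) (λ f → 2 ^ C d b * c)
    ≡⟨ sumTable-const d (suc b) (2 ^ C d b * c) ⟩
  2 ^ C d (suc b) * (2 ^ C d b * c)
    ≡⟨ *-assoc (2 ^ C d (suc b)) (2 ^ C d b) c ⟨
  2 ^ C d (suc b) * 2 ^ C d b * c
    ≡⟨ cong (_* c) (^-distribˡ-+-* 2 (C d (suc b)) (C d b)) ⟨
  2 ^ C (suc d) (suc b) * c ∎
  where open ≡-Reasoning

-- Recursion replaces an equality test on tables: the curried `k` is updated at `f₀`, where the new
-- row is the old row updated at `g₀`.
update : ∀ d b → Table d b → A → (Table d b → A) → Table d b → A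
update d       zero    true      x k true  = x
update d       zero    true      x k false = k false
update d       zero    false     x k true  = k true
update d       zero    false     x k false = x
update zero    (suc b) _         x k _ = x
update (suc d) (suc b) (f₀ , g₀) x k (f , g) =
  update d (suc b) f₀ (update d b g₀ x λ g → k (f₀ , g)) (λ f g → k (f , g)) f g

-- Asking `Ψ` of `k t` even at the overwritten `t₀` avoids comparing tables. In the search the old
-- subtrees do satisfy it, since validity passes to sublists.
update-elim : ∀ d b (Ψ : Table d b → A → Set) t₀ {x k} → Ψ t₀ x → (∀ t → Ψ t (k t)) →
              ∀ t → Ψ t (update d b t₀ x k t)
update-elim d       zero    Ψ true      ψx ψk true  = ψx
update-elim d       zero    Ψ true      ψx ψk false = ψk false
update-elim d       zero    Ψ false     ψx ψk true  = ψk true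
update-elim d       zero    Ψ false     ψx ψk false = ψx
update-elim zero    (suc b) Ψ tt        ψx ψk tt    = ψx
update-elim {A = A} (suc d) (suc b) Ψ (f₀ , g₀) ψx ψk (f , g) =
  update-elim {A = Table d b → A} d (suc b) (λ f h → ∀ g → Ψ (f , g) (h g)) f₀
    (update-elim d b (λ g → Ψ (f₀ , g)) g₀ ψx (λ g → ψk (f₀ , g)))
    (λ f g → ψk (f , g)) f g

-- Keeps count of the free places: filling one place in one child lowers the sum over all children
-- by exactly one.
sumTable-update : ∀ d b (φ : A → ℕ) t₀ {x} (k : Table d b → A) → suc (φ x) ≡ φ (k t₀) →
                  suc (sumTable d b (φ ∘ update d b t₀ x k)) ≡ sumTable d b (φ ∘ k)
sumTable-update d       zero    φ true      k e = cong (_+ φ (k false)) e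
sumTable-update d       zero    φ false {x} k e =
  trans (sym (+-suc (φ (k true)) (φ x))) (cong (φ (k true) +_) e)
sumTable-update zero    (suc b) φ tt        k e = e
sumTable-update (suc d) (suc b) φ (f₀ , g₀) k e =
  sumTable-update d (suc b) (λ h → sumTable d b (φ ∘ h)) f₀ (λ f g → k (f , g))
    (sumTable-update d b φ g₀ (λ g → k (f₀ , g)) e)

-- Halving the list of candidates

split : (q : A → Bool) (Z : List A) → ∃₂ λ T F → T ⊑ Z × F ⊑ Z ×
        All (λ z → q z ≡ true) T × All (λ z → q z ≡ false) F × length Z ≡ length T + length F
split q []      = [] , [] , [] , [] , [] , [] , refl
split q (z ∷ Z) with T , F , T⊑ , F⊑ , true! , false! , e ← split q Z | q z in eq
... | true  = z ∷ T , F , refl ∷ T⊑ , z ∷ʳ F⊑ , eq ∷ true! , false! , cong suc e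
... | false = T , z ∷ F , z ∷ʳ T⊑ , refl ∷ F⊑ , true! , eq ∷ false! ,
              trans (cong suc e) (sym (+-suc (length T) (length F)))

Unique-⊑ : {Z Z′ : List A} → Z′ ⊑ Z → Unique Z → Unique Z′
Unique-⊑ []           []            = []
Unique-⊑ (_ ∷ʳ Z′⊑Z)   (_   ∷ unique) = Unique-⊑ Z′⊑Z unique
Unique-⊑ (refl ∷ Z′⊑Z) (z∉Z ∷ unique) = All-resp-⊆ Z′⊑Z z∉Z ∷ Unique-⊑ Z′⊑Z unique

n+n≤n*2 : ∀ n → n + n ≤ n * 2
n+n≤n*2 n = ≤-reflexive (trans (cong (n +_) (sym (+-identityʳ n))) (*-comm 2 n))

halve : (q : A → Bool) (Z : List A) → ∃₂ λ β Z′ → Z′ ⊑ Z ×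
        length Z ≤ length Z′ * 2 × All (λ z → q z ≡ β) Z′
halve q Z with T , F , T⊑ , F⊑ , true! , false! , e ← split q Z | ≤-total (length T) (length F)
... | inj₁ T≤F = false , F , F⊑ ,
  ≤-trans (≤-reflexive e) (≤-trans (+-monoˡ-≤ _ T≤F) (n+n≤n*2 (length F))) , false!
... | inj₂ F≤T = true , T , T⊑ ,
  ≤-trans (≤-reflexive e) (≤-trans (+-monoʳ-≤ _ F≤T) (n+n≤n*2 (length T))) , true!

size-0 : (S : Subset d) → ∣ S ∣ ≡ 0 → S ≡ Vec.replicate d outside
size-0 []            _ = refl
size-0 (outside ∷ S) e = cong (outside ∷_) (size-0 S e)

Answers : ∀ d b → (A → Subset d → Bool) → Table d b → A → Set
Answers d b q t z = ∀ S → ∣ S ∣ ≡ b → q z S ≡ entry d b t S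

-- One halving per `b`-subset; answers already obtained survive each passage to a sublist.
settle : ∀ d b (q : A → Subset d → Bool) (Z : List A) → ∃₂ λ t Z′ → Z′ ⊑ Z ×
         length Z ≤ length Z′ * 2 ^ C d b × All (Answers d b q t) Z′
settle d zero q Z with β , Z′ , Z′⊑ , Z≤ , β! ← halve (λ z → q z (Vec.replicate d outside)) Z =
  β , Z′ , Z′⊑ , Z≤ , All.map (λ {z} e S s → trans (cong (q z) (size-0 S s)) e) β!
settle zero    (suc b) q Z = tt , Z , ⊆-refl , ≤-reflexive (sym (*-identityʳ _)) ,
  All.universal (λ { z [] () }) Z
settle (suc d) (suc b) q Z
  with f , Y , Y⊑Z , Z≤Y , f! ← settle d (suc b) (λ z S → q z (outside ∷ S)) Z
  with g , X , X⊑Y , Y≤X , g! ← settle d b (λ z S → q z (inside ∷ S)) Y =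
  (f , g) , X , ⊆-trans X⊑Y Y⊑Z , bound ,
  All.zipWith (λ { (f! , g!) (outside ∷ S) s → f! S s
                 ; (f! , g!) (inside  ∷ S) s → g! S (suc-injective s) }) (All-resp-⊆ X⊑Y f! , g!)
  where
  bound : length Z ≤ length X * 2 ^ (C d (suc b) + C d b)
  bound = begin
    length Z                                    ≤⟨ Z≤Y ⟩
    length Y * 2 ^ C d (suc b)                  ≤⟨ *-monoˡ-≤ (2 ^ C d (suc b)) Y≤X ⟩
    length X * 2 ^ C d b * 2 ^ C d (suc b)      ≡⟨ *-assoc (length X) _ _ ⟩
    length X * (2 ^ C d b * 2 ^ C d (suc b))    ≡⟨ cong (length X *_) (^-distribˡ-+-* 2 (C d b) _) ⟨
    length X * 2 ^ (C d b + C d (suc b))        ≡⟨ cong (λ c → length X * 2 ^ c) (+-comm (C d b) _) ⟩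
    length X * 2 ^ (C d (suc b) + C d b)        ∎
    where open ≤-Reasoning

-- Search trees and their places

-- The number of places of a tree of height r whose root lies at depth d.
slots : ℕ → ℕ → ℕ → ℕ
slots b zero    d = 0
slots b (suc r) d = suc (sumTable d b λ _ → slots b r (suc d))

-- The whole tree has `2 ^ C d (suc b)` places at depth `d`, so the left side counts its places on
-- the `r` levels from `d` on. Each of these levels has at most `2 ^ C (r + d) (suc b)`.
slots-bound : ∀ b r d → slots b r d * 2 ^ C d (suc b) ≤ r * 2 ^ C (r + d) (suc b)
slots-bound b zero    d = z≤n
slots-bound b (suc r) d = begin
  2 ^ C d (suc b) + sumTable d b (λ _ → s) * 2 ^ C d (suc b)
    ≡⟨ cong (λ x → 2 ^ C d (suc b) + x * 2 ^ C d (suc b)) (sumTable-const d b s) ⟩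
  2 ^ C d (suc b) + 2 ^ C d b * s * 2 ^ C d (suc b)
    ≡⟨ cong (2 ^ C d (suc b) +_) (xy∙z≈y∙zx (2 ^ C d b) s _) ⟩
  2 ^ C d (suc b) + s * (2 ^ C d (suc b) * 2 ^ C d b)
    ≡⟨ cong (λ x → 2 ^ C d (suc b) + s * x) (^-distribˡ-+-* 2 (C d (suc b)) (C d b)) ⟨
  2 ^ C d (suc b) + s * 2 ^ C (suc d) (suc b)
    ≤⟨ +-mono-≤ (^-monoʳ-≤ 2 (C-monoˡ (suc b) d≤′1+r+d)) (slots-bound b r (suc d)) ⟩
  2 ^ C (suc r + d) (suc b) + r * 2 ^ C (r + suc d) (suc b)
    ≡⟨ cong (λ e → 2 ^ C (suc r + d) (suc b) + r * 2 ^ C e (suc b)) (+-suc r d) ⟩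
  suc r * 2 ^ C (suc r + d) (suc b) ∎
  where
  open ≤-Reasoning
  s = slots b r (suc d)
  d≤′1+r+d : d ≤′ suc r + d
  d≤′1+r+d = ≤⇒≤′ (m≤n+m d (suc r))

-- A child corresponds to the answers on the `suc b`-subsets containing the node's vertex, hence to
-- one Boolean per `b`-subset of the `d` vertices above. At `r = 0`, `vacant` is the end of a full
-- branch and offers no place.
data Tree (A : Set) (b : ℕ) : (r d : ℕ) → Set where
  vacant : Tree A b r d
  node   : A → (Table d b → Tree A b r (suc d)) → Tree A b (suc r) d

free : Tree A b r d → ℕ
free {b = b} {r} {d} vacant     = slots b r d
free {b = b} {d = d} (node x k) = sumTable d b (free ∘ k)

-- From sets of positions to sets of vertices

image : Vec (Fin n) d → Subset d → Subset n
image []       []            = Vec.replicate _ outside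
image (y ∷ ys) (outside ∷ S) = image ys S
image (y ∷ ys) (inside  ∷ S) = ⁅ y ⁆ ∪ image ys S

∈-image⁺ : ∀ (ys : Vec (Fin n) d) {S i} → i ∈ S → lookup ys i ∈ image ys S
∈-image⁺ (y ∷ ys) {inside  ∷ S} here        = x∈p∪q⁺ (inj₁ (x∈⁅x⁆ y))
∈-image⁺ (y ∷ ys) {inside  ∷ S} (there i∈S) = x∈p∪q⁺ {p = ⁅ y ⁆} (inj₂ (∈-image⁺ ys i∈S))
∈-image⁺ (y ∷ ys) {outside ∷ S} (there i∈S) = ∈-image⁺ ys i∈S

∈-image⁻ : ∀ (ys : Vec (Fin n) d) S {v} → v ∈ image ys S → ∃ λ i → i ∈ S × lookup ys i ≡ v
∈-image⁻ []       []            v∈ = contradiction v∈ ∉⊥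
∈-image⁻ (y ∷ ys) (outside ∷ S) v∈ with i , i∈S , e ← ∈-image⁻ ys S v∈ = suc i , there i∈S , e
∈-image⁻ (y ∷ ys) (inside  ∷ S) v∈ with x∈p∪q⁻ ⁅ y ⁆ (image ys S) v∈
... | inj₁ v∈⁅y⁆ = zero , here , sym (x∈⁅y⁆⇒x≡y y v∈⁅y⁆)
... | inj₂ v∈S with i , i∈S , e ← ∈-image⁻ ys S v∈S = suc i , there i∈S , e

⊆-image : ∀ (ys : Vec (Fin n) d) H {S} → S ⊆ image ys H → ∃ λ S′ → S′ ⊆ H × image ys S′ ≡ S
⊆-image ys H {S} S⊆H = S′ , proj₂ ∘ x∈p∩q⁻ (Vec.map (lookup S) ys) H , ⊆-antisym S′⊆S S⊆S′
  where
  -- `ys` may repeat vertices here, so a position outside `H` can carry a vertex of `S`; the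
  -- intersection removes it.
  S′ = Vec.map (lookup S) ys ∩ H

  S′⊆S : image ys S′ ⊆ S
  S′⊆S v∈ with i , i∈S′ , refl ← ∈-image⁻ ys S′ v∈ =
    lookup⇒[]= _ S (trans (sym (lookup-map i (lookup S) ys))
                          ([]=⇒lookup (proj₁ (x∈p∩q⁻ (Vec.map (lookup S) ys) H i∈S′))))

  S⊆S′ : S ⊆ image ys S′
  S⊆S′ v∈S with i , i∈H , refl ← ∈-image⁻ ys H (S⊆H v∈S) =
    ∈-image⁺ ys (x∈p∩q⁺ (lookup⇒[]= i _ (trans (lookup-map i (lookup S) ys) ([]=⇒lookup v∈S)) , i∈H))

∣⁅x⁆∪p∣ : ∀ (x : Fin n) p → x ∉ p → ∣ ⁅ x ⁆ ∪ p ∣ ≡ suc ∣ p ∣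
∣⁅x⁆∪p∣ zero    (inside  ∷ p) x∉p = contradiction here x∉p
∣⁅x⁆∪p∣ zero    (outside ∷ p) x∉p = cong (suc ∘ ∣_∣) (∪-identityˡ p)
∣⁅x⁆∪p∣ (suc x) (inside  ∷ p) x∉p = cong suc (∣⁅x⁆∪p∣ x p (x∉p ∘ there))
∣⁅x⁆∪p∣ (suc x) (outside ∷ p) x∉p = ∣⁅x⁆∪p∣ x p (x∉p ∘ there)

-- Building the search tree

-- suc b stands for a - 2. Branches list the most recently placed vertex first.
module Search {n : ℕ} (col : Subset n → Bool) (b : ℕ) where

  -- Later tables on the branch extend `f`, so the colour of `S ∪ {y , w}` comes to depend on `S`
  -- alone. Distinctness keeps the sizes of images right.
  Settled : Vec (Fin n) d → Table d (suc b) → Fin n → Fin n → Set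
  Settled ys f y w =
    y ≢ w × Answers _ (suc b) (λ w S → col (image (w ∷ y ∷ ys) (inside ∷ inside ∷ S))) f w

  -- Only the entries of f at subsets avoiding the head of the branch matter: those for subsets
  -- containing it are the answers that decide on which child the next vertex is placed.
  Later : Vec (Fin n) d → Table d (suc b) → Fin n → Set
  Later []       _       w = Unit
  Later (y ∷ ys) (f , _) w = Later ys f w × Settled ys f y w

  Chain : Vec (Fin n) d → Table d (suc b) → Set
  Chain []       _       = Unit
  Chain (y ∷ ys) (f , _) = Chain ys f × Later ys f y

  Branch : ℕ → Set
  Branch m = ∃₂ λ (ys : Vec (Fin n) m) f → ∃ λ w → Chain ys f × Later ys f w

  -- Every placed vertex stays settled against all remaining candidates, so that any of them may
  -- descend past it.
  Valid : List (Fin n) → Vec (Fin n) d → Table d (suc b) → Tree (Fin n) b r d → Set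
  Valid Z ys f vacant     = Unit
  Valid Z ys f (node x k) =
    Later ys f x × All (Settled ys f x) Z × ∀ g → Valid Z (x ∷ ys) (f , g) (k g)

  Valid-⊑ : ∀ {Z Z′} {ys : Vec (Fin n) d} {f} (t : Tree (Fin n) b r d) →
            Z′ ⊑ Z → Valid Z ys f t → Valid Z′ ys f t
  Valid-⊑ vacant     Z′⊑Z _                 = tt
  Valid-⊑ (node x k) Z′⊑Z (later , all , v) =
    later , All-resp-⊆ Z′⊑Z all , λ g → Valid-⊑ (k g) Z′⊑Z (v g)

  -- Descending past a node at depth `d` settles `C d b` questions, which turns `C d (suc b)` into
  -- `C (suc d) (suc b)`. Places have depth at most `p`, so the factor lost from depth `d` on is at
  -- most the quotient of the two powers in the bound, which is cross-multiplied.
  insert : ∀ {p w Z} (t : Tree (Fin n) b r d) (ys : Vec (Fin n) d) f → r + d ≡ suc p →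
           Chain ys f → Later ys f w → Valid (w ∷ Z) ys f t → All (Settled ys f w) Z →
           Branch (suc p) ⊎
           ∃₂ λ (t′ : Tree (Fin n) b r d) Z′ → Z′ ⊑ Z ×
             length Z * 2 ^ C d (suc b) ≤ length Z′ * 2 ^ C p (suc b) ×
             Valid Z′ ys f t′ × suc (free t′) ≡ free t
  -- At height 0 the branch already holds `suc p` vertices, and `w` is the one more.
  insert {r = zero}  vacant ys f refl chain later _ _ = inj₁ (ys , f , _ , chain , later)
  insert {r = suc r} {d} {w = w} {Z} vacant ys f refl chain later _ all =
    inj₂ (node w (λ _ → vacant) , Z , ⊆-refl ,
          *-monoʳ-≤ (length Z) (^-monoʳ-≤ 2 (C-monoˡ (suc b) (≤⇒≤′ (m≤n+m d r)))) ,
          (later , all , λ _ → tt) , refl)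
  insert {r = suc r} {d} {p} {w} {Z} (node x k) ys f e chain later (laterₓ , sₓ ∷ allₓ , v) all
    -- The questions concern `S ∪ {x , w , z}` for `b`-subsets `S` of `ys`; the answers `g` choose
    -- the child of `x` into which `w` descends. Answers on sets avoiding `x` are inherited from
    -- `all`.
    with settle d b (λ z S → col (image (z ∷ w ∷ x ∷ ys) (inside ∷ inside ∷ inside ∷ S))) Z
  ... | g , Y , Y⊑Z , Z≤Y , g!
    with insert (k g) (x ∷ ys) (f , g) (trans (+-suc r d) e) (chain , laterₓ) (later , sₓ)
           (Valid-⊑ (k g) (refl ∷ Y⊑Z) (v g))
           (All.zipWith (λ { ((w≢z , f!) , g!) → w≢z , λ where
                               (outside ∷ S) s → f! S s
                               (inside  ∷ S) s → g! S (suc-injective s) })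
                        (All-resp-⊆ Y⊑Z all , g!))
  ... | inj₁ branch = inj₁ branch
  ... | inj₂ (t , Z′ , Z′⊑Y , Y≤Z′ , valid , size) =
    inj₂ (node x (update d b g t k) , Z′ , Z′⊑Z , bound ,
          (laterₓ , All-resp-⊆ Z′⊑Z allₓ ,
           update-elim d b (λ g → Valid Z′ (x ∷ ys) (f , g)) g valid
             (λ g → Valid-⊑ (k g) (_ ∷ʳ Z′⊑Z) (v g))) ,
          sumTable-update d b free g k size)
    where
    Z′⊑Z = ⊆-trans Z′⊑Y Y⊑Z
    bound : length Z * 2 ^ C d (suc b) ≤ length Z′ * 2 ^ C p (suc b)
    bound = begin
      length Z * 2 ^ C d (suc b)                ≤⟨ *-monoˡ-≤ (2 ^ C d (suc b)) Z≤Y ⟩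
      length Y * 2 ^ C d b * 2 ^ C d (suc b)    ≡⟨ *-assoc (length Y) _ _ ⟩
      length Y * (2 ^ C d b * 2 ^ C d (suc b))
        ≡⟨ cong (length Y *_) (trans (*-comm (2 ^ C d b) _) (sym (^-distribˡ-+-* 2 (C d (suc b)) _))) ⟩
      length Y * 2 ^ C (suc d) (suc b)          ≤⟨ Y≤Z′ ⟩
      length Z′ * 2 ^ C p (suc b)               ∎
      where open ≤-Reasoning

  -- An insertion that yields no full branch uses up one of the `N` free places, so a candidate left
  -- over when no place is free forces a branch. The `suc` in the exponent pays for removing `w`
  -- from the list.
  grow : ∀ N {p Z} (t : Tree (Fin n) b (suc p) 0) → free t ≡ N → Valid Z [] tt t → Unique Z →
         2 ^ (N * suc (C p (suc b))) ≤ length Z → Branch (suc p)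
  grow N {p} {[]} t _ _ _ 2^≤0 =
    contradiction (≤-trans (m^n>0 2 (N * suc (C p (suc b)))) 2^≤0) λ ()
  grow N {p} {w ∷ Z} t e valid (w∉Z ∷ unique) 2^≤Z
    with insert t [] tt (+-identityʳ _) tt tt valid (All.map (λ w≢z → w≢z , λ { [] () }) w∉Z)
  ... | inj₁ branch = branch
  grow zero {p} {w ∷ Z} t e _ _ _ | inj₂ (t′ , _ , _ , _ , _ , size) = contradiction (trans size e) λ ()
  grow (suc N) {p} {w ∷ Z} t e _ (_ ∷ unique) 2^≤Z | inj₂ (t′ , Z′ , Z′⊑Z , Z≤Z′ , valid′ , size) =
    grow N t′ (suc-injective (trans size e)) valid′ (Unique-⊑ Z′⊑Z unique) bound
    where
    bound : 2 ^ (N * suc (C p (suc b))) ≤ length Z′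
    bound = *-cancelʳ-≤ _ _ (2 ^ c) ⦃ m^n≢0 2 c ⦄ (begin
      2 ^ u * 2 ^ c          ≤⟨ X≤∣Z∣ ⟩
      length Z               ≡⟨ *-identityʳ (length Z) ⟨
      length Z * 1           ≤⟨ Z≤Z′ ⟩
      length Z′ * 2 ^ c      ∎)
      where
      open ≤-Reasoning
      c = C p (suc b)
      u = N * suc c
      X = 2 ^ u * 2 ^ c
      X≤∣Z∣ : X ≤ length Z
      X≤∣Z∣ = s≤s⁻¹ (begin
        1 + X                ≤⟨ +-monoˡ-≤ X (*-mono-≤ (m^n>0 2 u) (m^n>0 2 c)) ⟩
        X + X                ≡⟨ cong (X +_) (+-identityʳ X) ⟨
        2 * (2 ^ u * 2 ^ c)  ≡⟨ cong (2 *_) (trans (*-comm (2 ^ u) _) (sym (^-distribˡ-+-* 2 c u))) ⟩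
        2 ^ (suc N * suc c)  ≤⟨ 2^≤Z ⟩
        suc (length Z)       ∎)

  -- Colours along a branch

  later-≢ : ∀ {w} (ys : Vec (Fin n) d) f → Later ys f w → ∀ i → lookup ys i ≢ w
  later-≢ (y ∷ ys) _       (later , y≢w , _) zero    = y≢w
  later-≢ (y ∷ ys) (f , _) (later , _)       (suc i) = later-≢ ys f later i

  later-∉ : ∀ {w} (ys : Vec (Fin n) d) f → Later ys f w → ∀ S → w ∉ image ys S
  later-∉ ys f later S w∈ with i , _ , e ← ∈-image⁻ ys S w∈ = later-≢ ys f later i e

  ∣image∣ : ∀ (ys : Vec (Fin n) d) f → Chain ys f → ∀ S → ∣ image ys S ∣ ≡ ∣ S ∣
  ∣image∣ []       _       _               []            = ∣⊥∣≡0 n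
  ∣image∣ (y ∷ ys) (f , _) (chain , later) (outside ∷ S) = ∣image∣ ys f chain S
  ∣image∣ (y ∷ ys) (f , _) (chain , later) (inside  ∷ S) =
    trans (∣⁅x⁆∪p∣ y (image ys S) (later-∉ ys f later S)) (cong suc (∣image∣ ys f chain S))

  -- The first `inside` of `S` marks its most recent vertex `y`. There `Settled` gives the colour of
  -- the rest together with `y` and `w`, and `S₀` drops this position.
  later-color : ∀ {w} (ys : Vec (Fin n) d) f → Later ys f w → ∀ S → ∣ S ∣ ≡ 2 + b →
                ∃ λ S₀ → S₀ ⊆ S × ∣ S₀ ∣ ≡ 1 + b ×
                  col (image (w ∷ ys) (inside ∷ S)) ≡ entry d (suc b) f S₀
  later-color (y ∷ ys) (f , _) (_ , _ , f!) (inside ∷ S) s =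
    outside ∷ S , out⊆ id , suc-injective s , f! S (suc-injective s)
  later-color (y ∷ ys) (f , _) (later , _) (outside ∷ S) s
    with S₀ , S₀⊆S , s₀ , e ← later-color ys f later S s = outside ∷ S₀ , out⊆ S₀⊆S , s₀ , e

  chain-color : ∀ (ys : Vec (Fin n) d) f → Chain ys f → ∀ S → ∣ S ∣ ≡ 3 + b →
                ∃ λ S₀ → S₀ ⊆ S × ∣ S₀ ∣ ≡ 1 + b × col (image ys S) ≡ entry d (suc b) f S₀
  chain-color (y ∷ ys) (f , _) (chain , later) (inside ∷ S) s
    with S₀ , S₀⊆S , s₀ , e ← later-color ys f later S (suc-injective s) =
    outside ∷ S₀ , out⊆ S₀⊆S , s₀ , e
  chain-color (y ∷ ys) (f , _) (chain , later) (outside ∷ S) s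
    with S₀ , S₀⊆S , s₀ , e ← chain-color ys f chain S s = outside ∷ S₀ , out⊆ S₀⊆S , s₀ , e

  -- As the most recent vertex, `w` never enters `S₀`, so it joins the set given by `H` for free;
  -- this is the gain from `k - 1` to `k`.
  branch-color : ∀ {w} (ys : Vec (Fin n) d) f → Chain ys f → Later ys f w →
                 ∀ {H} S → S ⊆ inside ∷ H → ∣ S ∣ ≡ 3 + b →
                 ∃ λ S₀ → S₀ ⊆ H × ∣ S₀ ∣ ≡ 1 + b × col (image (w ∷ ys) S) ≡ entry d (suc b) f S₀
  branch-color ys f chain later (inside ∷ S) S⊆ s
    with S₀ , S₀⊆S , s₀ , e ← later-color ys f later S (suc-injective s) =
    S₀ , drop-∷-⊆ S⊆ ∘ S₀⊆S , s₀ , e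
  branch-color ys f chain later (outside ∷ S) S⊆ s
    with S₀ , S₀⊆S , s₀ , e ← chain-color ys f chain S s =
    S₀ , drop-∷-⊆ S⊆ ∘ S₀⊆S , s₀ , e

-- From a full branch to a homogeneous set

total : ∀ {a} → Coloring n a → Subset n → Bool
total {a = a} COL S with ∣ S ∣ ≟ a
... | yes s = COL (S , s)
-- The default lets the search ask for the colour of an `image` whose size is not yet known.
... | no  _ = false

total-≡ : ∀ {a} (COL : Coloring n a) S → COL S ≡ total COL (proj₁ S)
total-≡ {a = a} COL (S , s) with ∣ S ∣ ≟ a
... | yes s′ = cong (λ s → COL (S , s)) (≡-irrelevant s s′)
... | no ¬s  = contradiction s ¬s

module _ {b : ℕ} (COL : Coloring n (3 + b)) where
  open Search (total COL) b

  branch⇒homogeneous : ∀ {m k} → Ramsey (1 + b) k m → Branch m →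
                       ∃ λ H → Homogeneous COL H × ∣ H ∣ ≡ suc k
  branch⇒homogeneous {m} ramsey (ys , f , w , chain , later)
    -- The table `f` is itself a 2-coloring of the `1 + b`-subsets of the `m` positions.
    with H , hom , s ← ramsey (entry m (suc b) f ∘ proj₁) =
    image (w ∷ ys) (inside ∷ H) , homogeneous , trans (∣image∣′ (inside ∷ H)) (cong suc s)
    where
    ∣image∣′ : ∀ S → ∣ image (w ∷ ys) S ∣ ≡ ∣ S ∣
    ∣image∣′ (outside ∷ S) = ∣image∣ ys f chain S
    ∣image∣′ (inside  ∷ S) =
      trans (∣⁅x⁆∪p∣ w (image ys S) (later-∉ ys f later S)) (cong suc (∣image∣ ys f chain S))

    color : ∀ S → proj₁ S ⊆ image (w ∷ ys) (inside ∷ H) →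
            ∃ λ S₀ → proj₁ S₀ ⊆ H × COL S ≡ entry m (suc b) f (proj₁ S₀)
    color S@(_ , s) S⊆ with S′ , S′⊆ , refl ← ⊆-image (w ∷ ys) (inside ∷ H) S⊆
      with S₀ , S₀⊆H , s₀ , e ← branch-color ys f chain later S′ S′⊆ (trans (sym (∣image∣′ S′)) s) =
      (S₀ , s₀) , S₀⊆H , trans (total-≡ COL S) e

    homogeneous : Homogeneous COL (image (w ∷ ys) (inside ∷ H))
    homogeneous S T S⊆ T⊆
      with S₀ , S₀⊆H , eS ← color S S⊆ | T₀ , T₀⊆H , eT ← color T T⊆ =
      trans eS (trans (hom S₀ T₀ S₀⊆H T₀⊆H) (sym eT))

-- Counting candidates and the theorem

cost-bound : ∀ b p → slots b (suc p) 0 * suc (C p (suc b)) ≤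
             suc p ^ (2 + b) * 2 ^ (suc p ^ (1 + b))
cost-bound b p = begin
  slots b m 0 * suc (C p (suc b))
    -- The number of places, times the exponent of 2 lost per insertion.
    ≤⟨ *-mono-≤ slots≤ (C<suc^ p b) ⟩
  m * 2 ^ (m ^ suc b) * m ^ suc b
    ≡⟨ xy∙z≈xz∙y m (2 ^ (m ^ suc b)) (m ^ suc b) ⟩
  m ^ (2 + b) * 2 ^ (m ^ suc b) ∎
  where
  open ≤-Reasoning
  m = suc p
  slots≤ : slots b m 0 ≤ m * 2 ^ (m ^ suc b)
  slots≤ = begin
    -- `C 0 (suc b)` is 0, so the weight in `slots-bound` is 1 at the root.
    slots b m 0                  ≡⟨ *-identityʳ _ ⟨
    slots b m 0 * 1              ≤⟨ slots-bound b m 0 ⟩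
    m * 2 ^ C (m + 0) (suc b)    ≡⟨ cong (λ d → m * 2 ^ C d (suc b)) (+-identityʳ m) ⟩
    m * 2 ^ C m (suc b)          ≤⟨ *-monoʳ-≤ m (^-monoʳ-≤ 2 (C≤^ m (suc b))) ⟩
    m * 2 ^ (m ^ suc b)          ∎

ramsey-step : ∀ b k m → Ramsey (1 + b) (suc k) m →
              Ramsey (3 + b) (2 + k) (2 ^ (m ^ (2 + b) * 2 ^ (m ^ (1 + b))))
-- The empty set has no subset of size `suc k`, so `m` is positive.
ramsey-step b k zero ramsey COL with ([] , _ , ()) ← ramsey (λ _ → false)
ramsey-step b k (suc p) ramsey COL = branch⇒homogeneous COL ramsey
  (grow (slots b (suc p) 0) vacant refl tt (tabulate⁺ id) (begin
    2 ^ (slots b (suc p) 0 * suc (C p (suc b))) ≤⟨ ^-monoʳ-≤ 2 (cost-bound b p) ⟩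
    N                                           ≡⟨ length-tabulate id ⟨
    length (allFin N)                           ∎))
  where
  open ≤-Reasoning
  open Search (total COL) b
  N = 2 ^ (suc p ^ (2 + b) * 2 ^ (suc p ^ (1 + b)))

theoremA2 : ∀ (a k : ℕ) → 3 ≤ a → 3 ≤ k →
    R a k ≤ 2 ^ (R (a ∸ 2) (k ∸ 1) ^ (a ∸ 1) * 2 ^ (R (a ∸ 2) (k ∸ 1) ^ (a ∸ 2)))
theoremA2 (suc (suc (suc b))) (suc (suc (suc k))) (s≤s (s≤s (s≤s z≤n))) (s≤s (s≤s (s≤s z≤n))) =
  proj₂ (proj₂ (leastRamsey (3 + b) (3 + k)))
    (ramsey-step b (suc k) _ (proj₁ (proj₂ (leastRamsey (1 + b) (2 + k)))))
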